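{- Let $d$ be a positive odd integer divisible by $3$, let $r$ be a positive odd integer, let $a$ be an integer with $a\equiv 1\pmod{12}$, and let $b=2^d a-3^r$. Then the equation $$ax^d-y^2-z^2+xyz-b=0$$ has no solution $(x,y,z)\in\mathbb{Z}^3$ with $x\equiv 1\pmod{12}$ or $x\equiv 9\pmod{12}$. -}

module Defs where

open import Data.Integer.Base using (ℤ; +_; _-_)
open import Data.Integer.Divisibility.Signed using (_∣_)
open import Data.Nat.Base as ℕ using (ℕ)
open import Data.Product.Base using (∃-syntax)
open import Relation.Binary.PropositionalEquality.Core using (_≡_)

infix 4 _≡_[mod_]

_≡_[mod_] : ℤ → ℤ → ℕ → Set
m ≡ n [mod k ] = + k ∣ m - n

Odd : ℕ → Set
Odd n = ∃[ k ] n ≡ 2 ℕ.* k ℕ.+ 1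

{-# OPTIONS --safe #-}

-- Modulo 3 with x ≡ 1 the equation reads (y + z)² ≡ −1, which is impossible.
-- If x ≡ 9, put D = x − 2 ≡ −5 (mod 12).  Modulo D the equation reads
-- (y − z)² ≡ 3^r, and since r is odd and 3 is invertible modulo D, 3 is a
-- square modulo D.  A descent excludes this for all D ≡ ±5 (mod 12): choose an
-- even root t of t² ≡ 3 with |t| < |D|.  Then t² − 3, or (t² − 3)/3 if 3 divides
-- t, is ±1 modulo 12 and divisible by D, so the complementary divisor is again
-- ±5 modulo 12, divides t² − 3, and is smaller than D in absolute value.
module Submission where

open import Defs
open import Data.Empty using (⊥-elim)
open import Data.Integer.Base using (ℤ; +_; -[1+_]; _+_; _-_; -_; _*_; _^_; ∣_∣; _⊖_)
import Data.Integer.Divisibility.Signed as ℤ∣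
open import Data.Integer.DivMod using (_/ℕ_; _%ℕ_; n%ℕd<d; a≡a%ℕn+[a/ℕn]*n)
import Data.Integer.Properties as ℤ
open import Data.Integer.Tactic.RingSolver using (solve-∀)
open import Data.Nat.Base as ℕ using (ℕ; zero; suc; _<_; _≤_; z≤n; s≤s)
open import Data.Nat.Divisibility using (_∣_; _∣?_)
open import Data.Nat.Induction using (Acc; acc; <-wellFounded)
import Data.Nat.Properties as ℕ
open import Data.Product.Base using (∃-syntax; _×_; _,_)
open import Data.Sum.Base using (_⊎_; inj₁; inj₂; [_,_]′)
open import Relation.Binary.PropositionalEquality using (_≡_; refl; sym; trans; cong; cong₂; subst; module ≡-Reasoning)
open import Relation.Nullary.Decidable using (from-no)
open import Relation.Nullary.Negation.Core using (¬_)

open ℤ∣ using (divides; ∣m∣n⇒∣m+n; ∣m∣n⇒∣m-n; ∣n⇒∣m*n; ∣m⇒∣m*n; ∣m⇒∣-m; ∣⇒∣ᵤ)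
  renaming (_∣_ to _∣ℤ_)

-- The classes 5 and -5 modulo 12

infix 4 _≡±5[mod12]

_≡±5[mod12] : ℤ → Set
D ≡±5[mod12] = (D ≡ + 5 [mod 12 ]) ⊎ (D ≡ - + 5 [mod 12 ])

≡±5-neg : ∀ {D} → D ≡±5[mod12] → - D ≡±5[mod12]
≡±5-neg {D} (inj₁ p) = inj₂ (subst (+ 12 ∣ℤ_) (identity D) (∣m⇒∣-m p))
  where
  identity : ∀ D → - (D - + 5) ≡ - D - - + 5
  identity = solve-∀
≡±5-neg {D} (inj₂ p) = inj₁ (subst (+ 12 ∣ℤ_) (identity D) (∣m⇒∣-m p))
  where
  identity : ∀ D → - (D - - + 5) ≡ - D - + 5
  identity = solve-∀

-- The moduli and cofactors that arise may be negative; symmetry of the two classes under negation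
-- lets the descent run on natural numbers.
≡±5-abs : ∀ D → D ≡±5[mod12] → + ∣ D ∣ ≡±5[mod12]
≡±5-abs (+ _)    p = p
≡±5-abs -[1+ n ] p = ≡±5-neg { -[1+ n ]} p

≡±5-square : ∀ D → D ≡±5[mod12] → D * D ≡ + 1 [mod 12 ]
≡±5-square D = [ square (+ 5) (divides (+ 2) refl) , square (- + 5) (divides (+ 2) refl) ]′
  where
  identity : ∀ D e → (D - e) * (D + e) + (e * e - + 1) ≡ D * D - + 1
  identity = solve-∀

  square : ∀ e → e * e ≡ + 1 [mod 12 ] → D ≡ e [mod 12 ] → D * D ≡ + 1 [mod 12 ]
  square e e²≡1 D≡e = subst (+ 12 ∣ℤ_) (identity D e) (∣m∣n⇒∣m+n (∣m⇒∣m*n (D + e) D≡e) e²≡1)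

-- Since 25 ≡ 1, each of the classes 5 and -5 is its own inverse modulo 12, so `m` falls into the
-- class of `D`.
≡±5-inverse : ∀ D m → D ≡±5[mod12] → m * D ≡ + 1 [mod 12 ] → m ≡±5[mod12]
≡±5-inverse D m D≡±5 mD≡1 =
  [ (λ D≡e → inj₁ (inverse (+ 5) (divides (+ 2) refl) D≡e))
  , (λ D≡e → inj₂ (inverse (- + 5) (divides (+ 2) refl) D≡e)) ]′ D≡±5
  where
  identity : ∀ D m e → e * (m * D - + 1) - e * m * (D - e) - m * (e * e - + 1) ≡ m - e
  identity = solve-∀

  inverse : ∀ e → e * e ≡ + 1 [mod 12 ] → D ≡ e [mod 12 ] → m ≡ e [mod 12 ]
  inverse e e²≡1 D≡e = subst (+ 12 ∣ℤ_) (identity D m e)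
    (∣m∣n⇒∣m-n (∣m∣n⇒∣m-n (∣n⇒∣m*n e mD≡1) (∣n⇒∣m*n (e * m) D≡e)) (∣n⇒∣m*n m e²≡1))

≡±5-odd : ∀ D → D ≡±5[mod12] → ∃[ c ] D ≡ + 2 * c + + 1
≡±5-odd D = [ (λ (divides q eq) → + 6 * q + + 2 , trans (shift (+ 5) eq) (identity₊ q))
            , (λ (divides q eq) → + 6 * q - + 3 , trans (shift (- + 5) eq) (identity₋ q)) ]′
  where
  D-e+e : ∀ D e → D ≡ (D - e) + e
  D-e+e = solve-∀

  shift : ∀ e {i} → D - e ≡ i → D ≡ i + e
  shift e eq = trans (D-e+e D e) (cong (_+ e) eq)

  identity₊ : ∀ q → q * + 12 + + 5 ≡ + 2 * (+ 6 * q + + 2) + + 1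
  identity₊ = solve-∀

  identity₋ : ∀ q → q * + 12 + - + 5 ≡ + 2 * (+ 6 * q - + 3) + + 1
  identity₋ = solve-∀

-- Supplies `3 < n`, which absorbs the constant 3 when t² - 3 is compared with n².
≡±5⇒4≤ : ∀ n → + n ≡±5[mod12] → 4 ≤ n
≡±5⇒4≤ 0 (inj₁ p) = ⊥-elim (from-no (12 ∣? 5) (∣⇒∣ᵤ p))
≡±5⇒4≤ 0 (inj₂ p) = ⊥-elim (from-no (12 ∣? 5) (∣⇒∣ᵤ p))
≡±5⇒4≤ 1 (inj₁ p) = ⊥-elim (from-no (12 ∣? 4) (∣⇒∣ᵤ p))
≡±5⇒4≤ 1 (inj₂ p) = ⊥-elim (from-no (12 ∣? 6) (∣⇒∣ᵤ p))
≡±5⇒4≤ 2 (inj₁ p) = ⊥-elim (from-no (12 ∣? 3) (∣⇒∣ᵤ p))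
≡±5⇒4≤ 2 (inj₂ p) = ⊥-elim (from-no (12 ∣? 7) (∣⇒∣ᵤ p))
≡±5⇒4≤ 3 (inj₁ p) = ⊥-elim (from-no (12 ∣? 2) (∣⇒∣ᵤ p))
≡±5⇒4≤ 3 (inj₂ p) = ⊥-elim (from-no (12 ∣? 8) (∣⇒∣ᵤ p))
≡±5⇒4≤ (suc (suc (suc (suc n)))) _ = s≤s (s≤s (s≤s (s≤s z≤n)))

-- Even representatives, and t² - 3 at even t

even⊎odd : ∀ n → ∃[ k ] (n ≡ 2 ℕ.* k ⊎ n ≡ 2 ℕ.* k ℕ.+ 1)
even⊎odd zero = 0 , inj₁ refl
even⊎odd (suc n) with even⊎odd n
... | k , inj₁ eq = k , inj₂ (trans (cong suc eq) (ℕ.+-comm 1 (2 ℕ.* k)))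
... | k , inj₂ eq = suc k , inj₁ (begin
  suc n                  ≡⟨ cong suc eq ⟩
  suc (2 ℕ.* k ℕ.+ 1)    ≡⟨ cong suc (ℕ.+-comm (2 ℕ.* k) 1) ⟩
  2 ℕ.+ 2 ℕ.* k          ≡⟨ ℕ.*-suc 2 k ⟨
  2 ℕ.* suc k            ∎)
  where open ≡-Reasoning

-- For the remainder r of `t`, the numbers r and r - n have opposite parity because n is odd; the
-- even one is taken.
even-residue : ∀ n .{{_ : ℕ.NonZero n}} c → + n ≡ + 2 * c + + 1 → ∀ t →
               ∃[ v ] ∣ + 2 * v ∣ < n × + n ∣ℤ t - + 2 * v
even-residue n c n-odd t with even⊎odd (t %ℕ n)
... | k , inj₁ r≡2k = + k , subst (_< n) |2v|≡r (n%ℕd<d t n) , divides (t /ℕ n) (begin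
  t - + 2 * + k                                ≡⟨ cong₂ _-_ (a≡a%ℕn+[a/ℕn]*n t n) (sym (trans (cong +_ r≡2k) (ℤ.pos-* 2 k))) ⟩
  + (t %ℕ n) + (t /ℕ n) * + n - + (t %ℕ n)     ≡⟨ cancel (+ (t %ℕ n)) (t /ℕ n * + n) ⟩
  t /ℕ n * + n                                 ∎)
  where
  open ≡-Reasoning
  |2v|≡r : t %ℕ n ≡ ∣ + 2 * + k ∣
  |2v|≡r = trans r≡2k (sym (ℤ.abs-* (+ 2) (+ k)))

  cancel : ∀ r s → r + s - r ≡ s
  cancel = solve-∀
-- Here r - n = (2k + 1) - (2c + 1), so half of it is k - c, and the quotient grows by one. An odd r
-- is positive, which makes n - r < n strict.
... | k , inj₂ r≡2k+1 = + k - c , subst (_< n) (sym |2v|≡n-r) n-r<n , divides (t /ℕ n + + 1) (begin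
  t - + 2 * (+ k - c)                              ≡⟨ cong₂ _-_ (a≡a%ℕn+[a/ℕn]*n t n) 2v≡r-n ⟩
  + r + t /ℕ n * + n - (+ r - + n)                 ≡⟨ cancel (+ r) (t /ℕ n) (+ n) ⟩
  (t /ℕ n + + 1) * + n                             ∎)
  where
  open ≡-Reasoning
  r = t %ℕ n

  cancel : ∀ r q n → r + q * n - (r - n) ≡ (q + + 1) * n
  cancel = solve-∀

  identity : ∀ k c → + 2 * (k - c) ≡ + 2 * k + + 1 - (+ 2 * c + + 1)
  identity = solve-∀

  2v≡r-n : + 2 * (+ k - c) ≡ + r - + n
  2v≡r-n = begin
    + 2 * (+ k - c)                        ≡⟨ identity (+ k) c ⟩
    + 2 * + k + + 1 - (+ 2 * c + + 1)      ≡⟨ cong₂ (λ i j → i + + 1 - j) (ℤ.pos-* 2 k) n-odd ⟨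
    + (2 ℕ.* k ℕ.+ 1) - + n                ≡⟨ cong (λ i → + i - + n) r≡2k+1 ⟨
    + r - + n                              ∎

  |2v|≡n-r : ∣ + 2 * (+ k - c) ∣ ≡ n ℕ.∸ r
  |2v|≡n-r = begin
    ∣ + 2 * (+ k - c) ∣   ≡⟨ cong ∣_∣ (trans 2v≡r-n (ℤ.m-n≡m⊖n r n)) ⟩
    ∣ r ⊖ n ∣             ≡⟨ ℤ.∣⊖∣-< (n%ℕd<d t n) ⟩
    n ℕ.∸ r               ∎

  n-r<n : n ℕ.∸ r < n
  n-r<n = ℕ.∸-monoʳ-< (subst (0 <_) (sym r≡2k+1) (ℕ.m≤n+m 1 (2 ℕ.* k))) (ℕ.<⇒≤ (n%ℕd<d t n))

-- The part X of the value t² − 3 at t = 2v that is prime to 6.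
unit-part : ∀ D → D ≡±5[mod12] → ∀ v → let N = (+ 2 * v) * (+ 2 * v) - + 3 in D ∣ℤ N →
            ∃[ X ] D ∣ℤ X × X ∣ℤ N × ∣ X ∣ ≤ ∣ N ∣ × (X ≡ + 1 [mod 12 ] ⊎ X ≡ - + 1 [mod 12 ])
unit-part D D≡±5 v D∣N with v %ℕ 3 | n%ℕd<d v 3 | a≡a%ℕn+[a/ℕn]*n v 3
-- With v = 3w the value is 36w² - 3 = 3(12w² - 1). The factor 3 is removed, and `D` still divides
-- the rest because 3 is invertible modulo `D`.
... | 0 | _ | eq = X , D∣X , divides (+ 3) N≡3X
                 , subst (∣ X ∣ ≤_) (sym (trans (cong ∣_∣ N≡3X) (ℤ.abs-* (+ 3) X))) (ℕ.m≤n*m ∣ X ∣ 3)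
                 , inj₂ (divides (w * w) (unit w))
  where
  w = v /ℕ 3
  X = + 12 * (w * w) - + 1

  value : ∀ w → (+ 2 * (+ 0 + w * + 3)) * (+ 2 * (+ 0 + w * + 3)) - + 3 ≡ + 3 * (+ 12 * (w * w) - + 1)
  value = solve-∀

  unit : ∀ w → + 12 * (w * w) - + 1 - - + 1 ≡ w * w * + 12
  unit = solve-∀

  N≡3X : (+ 2 * v) * (+ 2 * v) - + 3 ≡ + 3 * X
  N≡3X = trans (cong (λ v → (+ 2 * v) * (+ 2 * v) - + 3) eq) (value w)

  -- D² = 1 + 12s gives X = D² X − 4s (3X).
  identity : ∀ D X s → D * (D * X) - + 4 * s * (+ 3 * X) ≡ X + X * (D * D - + 1 - s * + 12)
  identity = solve-∀

  D∣X : D ∣ℤ X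
  D∣X with ≡±5-square D D≡±5
  ... | divides s D²-1≡12s = subst (D ∣ℤ_) (begin
      D * (D * X) - + 4 * s * (+ 3 * X)    ≡⟨ identity D X s ⟩
      X + X * (D * D - + 1 - s * + 12)     ≡⟨ cong (λ i → X + X * i) (ℤ.i≡j⇒i-j≡0 D²-1≡12s) ⟩
      X + X * + 0                          ≡⟨ cong (λ i → X + i) (ℤ.*-zeroʳ X) ⟩
      X + + 0                              ≡⟨ ℤ.+-identityʳ X ⟩
      X                                    ∎)
    (∣m∣n⇒∣m-n (∣m⇒∣m*n (D * X) ℤ∣.∣-refl) (∣n⇒∣m*n (+ 4 * s) (subst (D ∣ℤ_) N≡3X D∣N)))
    where open ≡-Reasoning
-- If 3 does not divide v, then v² ≡ 1 modulo 3, so 4v² ≡ 4 modulo 12 and the value itself is ≡ 1.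
... | 1 | _ | eq = (+ 2 * v) * (+ 2 * v) - + 3 , D∣N , ℤ∣.∣-refl , ℕ.≤-refl
                 , inj₁ (divides (+ 3 * (w * w) + + 2 * w) (trans (cong (λ v → (+ 2 * v) * (+ 2 * v) - + 3 - + 1) eq) (unit w)))
  where
  w = v /ℕ 3

  unit : ∀ w → (+ 2 * (+ 1 + w * + 3)) * (+ 2 * (+ 1 + w * + 3)) - + 3 - + 1 ≡ (+ 3 * (w * w) + + 2 * w) * + 12
  unit = solve-∀
... | 2 | _ | eq = (+ 2 * v) * (+ 2 * v) - + 3 , D∣N , ℤ∣.∣-refl , ℕ.≤-refl
                 , inj₁ (divides (+ 3 * (w * w) + + 4 * w + + 1) (trans (cong (λ v → (+ 2 * v) * (+ 2 * v) - + 3 - + 1) eq) (unit w)))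
  where
  w = v /ℕ 3

  unit : ∀ w → (+ 2 * (+ 2 + w * + 3)) * (+ 2 * (+ 2 + w * + 3)) - + 3 - + 1 ≡ (+ 3 * (w * w) + + 4 * w + + 1) * + 12
  unit = solve-∀
... | suc (suc (suc _)) | s≤s (s≤s (s≤s ())) | _

-- Descent on the divisors of t² - 3

-- With u = |t| ≤ n - 1 and 3 < n: u² + 3 < u² + n ≤ (u + 1)n ≤ n².
∣t²-3∣<n² : ∀ n t → 4 ≤ n → ∣ t ∣ < n → ∣ t * t - + 3 ∣ < n ℕ.* n
∣t²-3∣<n² n t 4≤n u<n = begin-strict
  ∣ t * t - + 3 ∣              ≤⟨ ℤ.∣i-j∣≤∣i∣+∣j∣ (t * t) (+ 3) ⟩
  ∣ t * t ∣ ℕ.+ 3              ≡⟨ cong (ℕ._+ 3) (ℤ.abs-* t t) ⟩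
  ∣ t ∣ ℕ.* ∣ t ∣ ℕ.+ 3        <⟨ ℕ.+-monoʳ-< (∣ t ∣ ℕ.* ∣ t ∣) 4≤n ⟩
  ∣ t ∣ ℕ.* ∣ t ∣ ℕ.+ n        ≤⟨ ℕ.+-monoˡ-≤ n (ℕ.*-monoʳ-≤ ∣ t ∣ (ℕ.<⇒≤ u<n)) ⟩
  ∣ t ∣ ℕ.* n ℕ.+ n            ≡⟨ ℕ.+-comm (∣ t ∣ ℕ.* n) n ⟩
  suc ∣ t ∣ ℕ.* n              ≤⟨ ℕ.*-monoˡ-≤ n u<n ⟩
  n ℕ.* n                      ∎
  where open ℕ.≤-Reasoning

-- A root may be moved within its residue class. Evenness makes t² - 3 odd, as `unit-part` requires.
even-root : ∀ n → + n ≡±5[mod12] → ∀ t → + n ∣ℤ t * t - + 3 →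
            ∃[ v ] ∣ + 2 * v ∣ < n × + n ∣ℤ (+ 2 * v) * (+ 2 * v) - + 3
even-root n n≡±5 t n∣t²-3 =
  let c , n-odd = ≡±5-odd (+ n) n≡±5
      v , |2v|<n , n∣t-2v = even-residue n {{n≢0}} c n-odd t
  in v , |2v|<n , subst (+ n ∣ℤ_) (identity t (+ 2 * v)) (∣m∣n⇒∣m-n n∣t²-3 (∣m⇒∣m*n (t + + 2 * v) n∣t-2v))
  where
  n≢0 : ℕ.NonZero n
  n≢0 = ℕ.>-nonZero (ℕ.<-≤-trans (s≤s z≤n) (≡±5⇒4≤ n n≡±5))

  identity : ∀ t u → t * t - + 3 - (t - u) * (t + u) ≡ u * u - + 3
  identity = solve-∀

complementary-≡±5 : ∀ D m → D ≡±5[mod12] →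
                    (m * D ≡ + 1 [mod 12 ] ⊎ m * D ≡ - + 1 [mod 12 ]) → m ≡±5[mod12]
complementary-≡±5 D m D≡±5 (inj₁ mD≡1)  = ≡±5-inverse D m D≡±5 mD≡1
-- Here -m is the inverse of `D`, and the classes are symmetric.
complementary-≡±5 D m D≡±5 (inj₂ mD≡-1) = subst _≡±5[mod12] (ℤ.neg-involutive m)
  (≡±5-neg { - m} (≡±5-inverse D (- m) D≡±5 (subst (+ 12 ∣ℤ_) (negate m D) (∣m⇒∣-m mD≡-1))))
  where
  negate : ∀ m n → - (m * n - - + 1) ≡ - m * n - + 1
  negate = solve-∀

descent : ∀ n → + n ≡±5[mod12] → ∀ t → + n ∣ℤ t * t - + 3 →
          ∃[ m ] ∃[ u ] m < n × + m ≡±5[mod12] × + m ∣ℤ u * u - + 3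
descent n n≡±5 t n∣t²-3 =
  let v , |2v|<n , n∣N = even-root n n≡±5 t n∣t²-3
      X , n∣X , X∣N , |X|≤|N| , X≡±1 = unit-part (+ n) n≡±5 v n∣N
  in complement (+ 2 * v) X |2v|<n n∣X X∣N |X|≤|N| X≡±1
  where
  complement : ∀ u X → ∣ u ∣ < n → + n ∣ℤ X → X ∣ℤ u * u - + 3 → ∣ X ∣ ≤ ∣ u * u - + 3 ∣ →
               (X ≡ + 1 [mod 12 ] ⊎ X ≡ - + 1 [mod 12 ]) →
               ∃[ m ] ∃[ u ] m < n × + m ≡±5[mod12] × + m ∣ℤ u * u - + 3
  -- The new modulus is |m|, where X = mn. The root `u` is kept, since m divides X and X divides u²
  -- - 3; the size bound is |m|n ≤ |u² - 3| < n².
  complement u .(m * + n) |u|<n (divides m refl) X∣N |X|≤|N| X≡±1 =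
    ∣ m ∣ , u , |m|<n , ≡±5-abs m (complementary-≡±5 (+ n) m n≡±5 X≡±1) ,
    ℤ∣.∣-trans (ℤ∣.∣m∣∣m {m}) (ℤ∣.∣-trans (∣m⇒∣m*n (+ n) ℤ∣.∣-refl) X∣N)
    where
    open ℕ.≤-Reasoning

    |m|<n : ∣ m ∣ < n
    |m|<n = ℕ.*-cancelʳ-< n ∣ m ∣ n (begin-strict
      ∣ m ∣ ℕ.* n        ≡⟨ ℤ.abs-* m (+ n) ⟨
      ∣ m * + n ∣        ≤⟨ |X|≤|N| ⟩
      ∣ u * u - + 3 ∣    <⟨ ∣t²-3∣<n² n u (≡±5⇒4≤ n n≡±5) |u|<n ⟩
      n ℕ.* n            ∎)

-- Every admissible modulus yields a smaller one, so well-foundedness of `_<_` gives the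
-- contradiction.
3-nonresidue-acc : ∀ n → Acc _<_ n → + n ≡±5[mod12] → ∀ t → ¬ (+ n ∣ℤ t * t - + 3)
3-nonresidue-acc n (acc rec) n≡±5 t n∣t²-3 =
  let m , u , m<n , m≡±5 , m∣u²-3 = descent n n≡±5 t n∣t²-3
  in 3-nonresidue-acc m (rec m<n) m≡±5 u m∣u²-3

3-nonresidue : ∀ D → D ≡±5[mod12] → ∀ t → ¬ (D ∣ℤ t * t - + 3)
3-nonresidue D D≡±5 t D∣t²-3 =
  3-nonresidue-acc ∣ D ∣ (<-wellFounded ∣ D ∣) (≡±5-abs D D≡±5) t (ℤ∣.∣-trans (ℤ∣.∣m∣∣m {D}) D∣t²-3)

-- From odd powers of 3 to 3 itself

-- As `i` inverts 3 modulo `D`, replacing s by i·s divides the square by 9 and lowers the exponent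
-- by 2, until it is 1.
odd-power-of-3-residue⇒3-residue : ∀ D i → D ∣ℤ + 3 * i - + 1 → ∀ k s →
  D ∣ℤ s * s - (+ 3) ^ (2 ℕ.* k ℕ.+ 1) → ∃[ t ] D ∣ℤ t * t - + 3
odd-power-of-3-residue⇒3-residue D i 3i≡1 zero s p = s , p
odd-power-of-3-residue⇒3-residue D i 3i≡1 (suc k) s p =
  odd-power-of-3-residue⇒3-residue D i 3i≡1 k (i * s)
    (subst (D ∣ℤ_) (identity i s W)
      (∣m∣n⇒∣m+n (∣n⇒∣m*n (i * i) (subst (λ e → D ∣ℤ s * s - (+ 3) ^ (e ℕ.+ 1)) (ℕ.*-suc 2 k) p))
                 (∣n⇒∣m*n (W * (+ 3 * i + + 1)) 3i≡1)))
  where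
  W = (+ 3) ^ (2 ℕ.* k ℕ.+ 1)

  identity : ∀ i s W → i * i * (s * s - + 3 * (+ 3 * W)) + W * (+ 3 * i + + 1) * (+ 3 * i - + 1)
                     ≡ (i * s) * (i * s) - W
  identity = solve-∀

-- Congruences of powers, and -1 as a nonsquare modulo 3

i-j∣iⁿ-jⁿ : ∀ i j n → i - j ∣ℤ i ^ n - j ^ n
i-j∣iⁿ-jⁿ i j zero    = divides (+ 0) refl
i-j∣iⁿ-jⁿ i j (suc n) = subst (i - j ∣ℤ_) (identity i j (i ^ n) (j ^ n))
  (∣m∣n⇒∣m+n (∣n⇒∣m*n i (i-j∣iⁿ-jⁿ i j n)) (∣m⇒∣m*n (j ^ n) ℤ∣.∣-refl))
  where
  identity : ∀ i j I J → i * (I - J) + (i - j) * J ≡ i * I - j * J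
  identity = solve-∀

-1^odd : ∀ k → (- + 1) ^ (2 ℕ.* k ℕ.+ 1) ≡ - + 1
-1^odd k = begin
  (- + 1) ^ (2 ℕ.* k ℕ.+ 1)            ≡⟨ ℤ.^-distribˡ-+-* (- + 1) (2 ℕ.* k) 1 ⟩
  (- + 1) ^ (2 ℕ.* k) * (- + 1)        ≡⟨ cong (_* (- + 1)) (ℤ.^-*-assoc (- + 1) 2 k) ⟨
  (+ 1) ^ k * (- + 1)                  ≡⟨ cong (_* (- + 1)) (ℤ.^-zeroˡ k) ⟩
  - + 1                                ∎
  where open ≡-Reasoning

s≡c⇒3∣c²+1 : ∀ s c → s ≡ c [mod 3 ] → + 3 ∣ℤ s * s + + 1 → + 3 ∣ℤ c * c + + 1
s≡c⇒3∣c²+1 s c s≡c p = subst (+ 3 ∣ℤ_) (identity s c) (∣m∣n⇒∣m-n p (∣m⇒∣m*n (s + c) s≡c))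
  where
  identity : ∀ s c → s * s + + 1 - (s - c) * (s + c) ≡ c * c + + 1
  identity = solve-∀

s≡s%3 : ∀ s → s ≡ + (s %ℕ 3) [mod 3 ]
s≡s%3 s = divides (s /ℕ 3) (trans (cong (_- + (s %ℕ 3)) (a≡a%ℕn+[a/ℕn]*n s 3)) (cancel (+ (s %ℕ 3)) (s /ℕ 3 * + 3)))
  where
  cancel : ∀ r i → r + i - r ≡ i
  cancel = solve-∀

3∤s²+1 : ∀ s → ¬ (+ 3 ∣ℤ s * s + + 1)
3∤s²+1 s p with s %ℕ 3 | n%ℕd<d s 3 | s≡s%3 s
... | 0 | _ | s≡c = from-no (3 ∣? 1) (∣⇒∣ᵤ (s≡c⇒3∣c²+1 s (+ 0) s≡c p))
... | 1 | _ | s≡c = from-no (3 ∣? 2) (∣⇒∣ᵤ (s≡c⇒3∣c²+1 s (+ 1) s≡c p))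
... | 2 | _ | s≡c = from-no (3 ∣? 5) (∣⇒∣ᵤ (s≡c⇒3∣c²+1 s (+ 2) s≡c p))
... | suc (suc (suc _)) | s≤s (s≤s (s≤s ())) | _

-- The equation modulo 3 and modulo x - 2

corollary2p2 : (d r : ℕ) (a b : ℤ) →
    0 < d → Odd d → 3 ∣ d →
    0 < r → Odd r →
    a ≡ + 1 [mod 12 ] →
    b ≡ (+ 2) ^ d * a - (+ 3) ^ r →
    ¬ (∃[ x ] ∃[ y ] ∃[ z ]
    ((x ≡ + 1 [mod 12 ]) ⊎ (x ≡ + 9 [mod 12 ])) ×
    (a * x ^ d - y ^ 2 - z ^ 2 + x * y * z - b ≡ + 0))
corollary2p2 d r a b _ (l , refl) _ _ (k , refl) a≡1 refl (x , y , z , inj₁ x≡1 , eqn) =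
  3∤s²+1 (y + z) (subst (+ 3 ∣ℤ_)
    (trans (sym (ℤ.+-identityʳ _)) (trans (cong (λ e → terms - e) (sym eqn)) (identity a (x ^ d) T R x y z)))
    (∣m∣n⇒∣m+n (∣m∣n⇒∣m+n (∣m∣n⇒∣m+n (∣m∣n⇒∣m+n
      (∣n⇒∣m*n a (∣m∣n⇒∣m-n 3∣xᵈ-1 3∣T+1))
      (∣n⇒∣m*n (+ 2) (ℤ∣.∣-trans 3∣12 a≡1)))
      3∣R)
      (∣m⇒∣m*n (y * z) (ℤ∣.∣-trans 3∣12 x≡1)))
      (∣m⇒∣m*n (+ 1 + y * z) ℤ∣.∣-refl)))
  where
  T = (+ 2) ^ d
  R = (+ 3) ^ r
  -- Every summand is a multiple of 3, by x^d ≡ 1, 2^d ≡ -1, a ≡ x ≡ 1 and 3^r ≡ 0. Subtracting the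
  -- left side of the equation, which is 0, leaves (y + z)² + 1.
  terms = a * (x ^ d - + 1 - (T - - + 1)) + + 2 * (a - + 1) + R + (x - + 1) * (y * z) + + 3 * (+ 1 + y * z)

  -- The factors `y * + 1` and `z * + 1` are how `y ^ 2` and `z ^ 2` unfold, so `eqn` matches by
  -- computation.
  identity : ∀ a X T R x y z →
    a * (X - + 1 - (T - - + 1)) + + 2 * (a - + 1) + R + (x - + 1) * (y * z) + + 3 * (+ 1 + y * z)
      - (a * X - y * (y * + 1) - z * (z * + 1) + x * y * z - (T * a - R))
    ≡ (y + z) * (y + z) + + 1
  identity = solve-∀

  3∣12 : + 3 ∣ℤ + 12
  3∣12 = divides (+ 4) refl

  3∣xᵈ-1 : + 3 ∣ℤ x ^ d - + 1
  3∣xᵈ-1 = subst (λ i → + 3 ∣ℤ x ^ d - i) (ℤ.^-zeroˡ d)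
    (ℤ∣.∣-trans 3∣12 (ℤ∣.∣-trans x≡1 (i-j∣iⁿ-jⁿ x (+ 1) d)))

  3∣T+1 : + 3 ∣ℤ T - - + 1
  3∣T+1 = subst (λ i → + 3 ∣ℤ T - i) (-1^odd l) (i-j∣iⁿ-jⁿ (+ 2) (- + 1) d)

  3∣R : + 3 ∣ℤ R
  3∣R = subst (+ 3 ∣ℤ_) (sym (ℤ.^-distribˡ-+-* (+ 3) (2 ℕ.* k) 1)) (∣n⇒∣m*n ((+ 3) ^ (2 ℕ.* k)) ℤ∣.∣-refl)
corollary2p2 d r a b _ _ _ _ (k , refl) _ refl (x , y , z , inj₂ x≡9@(divides q x-9≡12q) , eqn) =
  -- With x = 9 + 12q one has D = 12q + 7 and 3 · (-(4q + 2)) - 1 = -D, which gives the inverse of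
  -- 3.
  let t , D∣t²-3 = odd-power-of-3-residue⇒3-residue D (- (+ 4 * q + + 2)) D∣3i-1 k (y - z) D∣[y-z]²-R
  in 3-nonresidue D (inj₂ (subst (+ 12 ∣ℤ_) (shift x) (∣m∣n⇒∣m+n x≡9 (divides (+ 1) refl)))) t D∣t²-3
  where
  D = x - + 2
  T = (+ 2) ^ d
  R = (+ 3) ^ r

  shift : ∀ x → x - + 9 + + 12 ≡ x - + 2 - - + 5
  shift = solve-∀

  inverse-of-3 : ∀ x q → + 3 * (- (+ 4 * q + + 2)) - + 1 ≡ - + 1 * (x - + 2) + (x - + 9 - q * + 12)
  inverse-of-3 = solve-∀

  D∣3i-1 : D ∣ℤ + 3 * (- (+ 4 * q + + 2)) - + 1
  D∣3i-1 = divides (- + 1) (trans (inverse-of-3 x q)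
    (trans (cong (λ e → - + 1 * D + e) (ℤ.i≡j⇒i-j≡0 x-9≡12q)) (ℤ.+-identityʳ _)))

  -- Modulo D, x ≡ 2 turns a·x^d - b into 3^r and xyz into 2yz.
  identity : ∀ a X T R x y z →
    a * (X - T) + (x - + 2) * (y * z)
      - (a * X - y * (y * + 1) - z * (z * + 1) + x * y * z - (T * a - R))
    ≡ (y - z) * (y - z) - R
  identity = solve-∀

  D∣[y-z]²-R : D ∣ℤ (y - z) * (y - z) - R
  D∣[y-z]²-R = subst (D ∣ℤ_)
    (trans (sym (ℤ.+-identityʳ _)) (trans (cong (λ e → a * (x ^ d - T) + D * (y * z) - e) (sym eqn)) (identity a (x ^ d) T R x y z)))
    (∣m∣n⇒∣m+n (∣n⇒∣m*n a (i-j∣iⁿ-jⁿ x (+ 2) d)) (∣m⇒∣m*n (y * z) ℤ∣.∣-refl))
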